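{- For every positive integer $n$, $$3S_n\equiv 0\pmod{2n+3},$$ where $S_n=\dfrac{\binom{6n}{3n}\binom{3n}{n}}{2(2n+1)\binom{2n}{n}}$.
   Context: For a positive integer $n$, $S_n=\dfrac{\binom{6n}{3n}\binom{3n}{n}}{2(2n+1)\binom{2n}{n}}$. It is a previously known result (Z.-W. Sun) that $S_n$ is an integer for every positive integer $n$; the congruence is between integers. -}

module Defs where

open import Data.Integer.Base as ℤ using (ℤ; +_)
open import Data.Integer.Divisibility.Signed using (_∣_)
open import Data.Nat.Base using (ℕ; NonZero; _+_; _*_; _∸_; _≤_; _!; >-nonZero)
open import Data.Nat.Combinatorics using (_C_; nCk≡n!/k![n-k]!; k![n∸k]!∣n!)
open import Data.Nat.Divisibility using (∣⇒≤)
open import Data.Nat.DivMod using (m≥n⇒m/n>0)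
open import Data.Nat.Properties using (_!≢0; _!*_!≢0; m*n≢0; m≤m+n; m≤n+m)
open import Data.Rational.Base using (ℚ; _/_)
open import Relation.Binary.PropositionalEquality.Core using (sym; subst)

nCk≢0 : ∀ {n k} → k ≤ n → NonZero (n C k)
nCk≢0 {n} {k} k≤n =
  subst NonZero (sym (nCk≡n!/k![n-k]! k≤n))
    (>-nonZero (m≥n⇒m/n>0 (∣⇒≤ (k![n∸k]!∣n! k≤n))))
  where instance
    _ = n !≢0
    _ = k !* (n ∸ k) !≢0

-- An exact quotient in ℚ (not truncated division in ℕ), so integrality
-- of S n is not built into the definition.
S : ℕ → ℚ
S n = (+ (((6 * n) C (3 * n)) * ((3 * n) C n)))
    / (2 * (2 * n + 1) * ((2 * n) C n))
  where instance
    2n+1≢0 : NonZero (2 * n + 1)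
    2n+1≢0 = >-nonZero (m≤n+m 1 (2 * n))
    denominator≢0 : NonZero (2 * (2 * n + 1) * ((2 * n) C n))
    denominator≢0 = m*n≢0 _ _ {{m*n≢0 2 (2 * n + 1)}} {{nCk≢0 (m≤m+n n (1 * n))}}

infix 4 _≡_[mod_]

_≡_[mod_] : ℤ → ℤ → ℤ → Set
a ≡ b [mod m ] = m ∣ (a ℤ.- b)

{-# OPTIONS --safe #-}
-- The number a = 4²ⁿ C(3n − 1/2, 2n) satisfies
-- a C(2n,n) = C(6n,3n) C(3n,n), so that a = 2(2n+1) Sₙ in ℚ.  More generally
-- put A j k = 4ᵏ C(j + k − 1/2, k).  Pascal's rule, together with
-- A 0 k = C(2k,k), shows that A j k is an integer, even for k > 0.  The absorption
-- identity (k+1) A j (k+1) = 2(2j+1) A (j+1) k, used once and twice, gives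
--   2n a = 2(2n+1) A (n+1) (2n−1),   n(2n−1) Sₙ = (2n+3) A (n+2) (2n−2).
-- The first makes Sₙ an integer.  Since 2n(2n−1) ≡ 12 (mod 2n+3), the second gives
-- 2n+3 ∣ 12 Sₙ, and 2n+3 is odd.
module Submission where

open import Defs
open import Data.Integer.Divisibility.Signed using (∣ᵤ⇒∣)
import Data.Integer.Properties as ℤ
open import Data.Nat.Base as ℕ using (ℕ; NonZero; zero; suc; _!; _∸_; _≤_)
open import Data.Nat.Combinatorics
  using (_C_; nCk≡n!/k![n-k]!; k![n∸k]!∣n!; nCk≡nC[n∸k]; nCk+nC[k+1]≡[n+1]C[k+1])
open import Data.Nat.DivMod using (m/n*n≡m)
open import Data.Nat.Divisibility as ℕ
  using (divides; m∣m*n; n∣m*n; ∣m∣n⇒∣m+n; ∣m+n∣m⇒∣n; ∣n⇒∣m*n)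
import Data.Nat.Properties as ℕ
open import Data.Nat.Tactic.RingSolver using (solve-∀)
open import Data.Product.Base using (∃-syntax; _×_; _,_)
open import Data.Rational.Base using (_/_)
open import Data.Rational.Properties using (fromℚᵘ-cong)
open import Data.Rational.Unnormalised.Base using (mkℚᵘ; *≡*)
open import Relation.Binary.PropositionalEquality
  using (_≡_; refl; sym; trans; cong; cong₂; subst; subst₂; module ≡-Reasoning)
open ≡-Reasoning

module _ where
  open import Data.Nat.Base using (_+_; _*_)

  -- Binomial coefficients through factorials.

  [j+k]Cj*j!k!≡[j+k]! : ∀ j k → ((j + k) C j) * (j ! * k !) ≡ (j + k) !
  [j+k]Cj*j!k!≡[j+k]! j k = begin
    ((j + k) C j) * (j ! * k !)
      ≡⟨ cong (λ i → ((j + k) C j) * (j ! * i !)) (ℕ.m+n∸m≡n j k) ⟨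
    ((j + k) C j) * (j ! * (j + k ∸ j) !)
      ≡⟨ cong (_* (j ! * (j + k ∸ j) !)) (nCk≡n!/k![n-k]! j≤j+k) ⟩
    (j + k) ! ℕ./ (j ! * (j + k ∸ j) !) * (j ! * (j + k ∸ j) !)
      ≡⟨ m/n*n≡m (k![n∸k]!∣n! j≤j+k) ⟩
    (j + k) ! ∎
    where
    j≤j+k = ℕ.m≤m+n j k
    instance
      _ = j ℕ.!* (j + k ∸ j) !≢0

  -- Multiplied by `j ! * k !`, both sides become `suc (j + k) !`.
  C-absorption : ∀ j k → suc k * (suc (j + k) C j) ≡ suc (j + k) * ((j + k) C j)
  C-absorption j k = ℕ.*-cancelʳ-≡ _ _ (j ! * k !) (begin
    suc k * (suc (j + k) C j) * (j ! * k !)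
      ≡⟨ shuffle (suc k) (suc (j + k) C j) (j !) (k !) ⟩
    (suc (j + k) C j) * (j ! * suc k !)
      ≡⟨ subst (λ i → (i C j) * (j ! * suc k !) ≡ i !) (ℕ.+-suc j k) ([j+k]Cj*j!k!≡[j+k]! j (suc k)) ⟩
    suc (j + k) * (j + k) !
      ≡⟨ cong (suc (j + k) *_) ([j+k]Cj*j!k!≡[j+k]! j k) ⟨
    suc (j + k) * (((j + k) C j) * (j ! * k !))
      ≡⟨ ℕ.*-assoc (suc (j + k)) ((j + k) C j) (j ! * k !) ⟨
    suc (j + k) * ((j + k) C j) * (j ! * k !) ∎)
    where
    instance
      _ = j ℕ.!* k !≢0
    shuffle : ∀ s c x y → s * c * (x * y) ≡ c * (x * (s * y))
    shuffle = solve-∀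

  -- Central binomial coefficients.

  central : ℕ → ℕ
  central k = (2 * k) C k

  2*[1+k] : ∀ k → 2 * suc k ≡ suc (suc (2 * k))
  2*[1+k] = solve-∀

  central-! : ∀ k → central k * (k ! * k !) ≡ (2 * k) !
  central-! k = subst (λ i → central k * (k ! * i !) ≡ (2 * k) !) (ℕ.+-identityʳ k)
    ([j+k]Cj*j!k!≡[j+k]! k (k + 0))

  central-suc : ∀ k → suc k * central (suc k) ≡ 2 * (2 * k + 1) * central k
  central-suc k = ℕ.*-cancelʳ-≡ _ _ (suc k ! * k !) (begin
    suc k * central (suc k) * (suc k ! * k !)
      ≡⟨ shuffle (suc k) (central (suc k)) (suc k !) (k !) ⟩
    central (suc k) * (suc k ! * suc k !)
      ≡⟨ central-! (suc k) ⟩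
    (2 * suc k) !
      ≡⟨ cong _! (2*[1+k] k) ⟩
    suc (suc (2 * k)) * (suc (2 * k) * (2 * k) !)
      ≡⟨ cong (λ x → suc (suc (2 * k)) * (suc (2 * k) * x)) (central-! k) ⟨
    suc (suc (2 * k)) * (suc (2 * k) * (central k * (k ! * k !)))
      ≡⟨ regroup k (central k) (k !) ⟩
    2 * (2 * k + 1) * central k * (suc k ! * k !) ∎)
    where
    instance
      _ = suc k ℕ.!* k !≢0
    shuffle : ∀ s c x y → s * c * (x * y) ≡ c * (x * (s * y))
    shuffle = solve-∀
    regroup : ∀ k c x → suc (suc (2 * k)) * (suc (2 * k) * (c * (x * x)))
            ≡ 2 * (2 * k + 1) * c * (suc k * x * x)
    regroup = solve-∀

  -- Pascal's rule splits the coefficient into the two middle entries of row `2 * k + 1`, which are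
  -- equal by symmetry.
  2∣central : ∀ k → 2 ℕ.∣ central (suc k)
  2∣central k = divides (n C k) (begin
    (2 * suc k) C suc k        ≡⟨ cong (_C suc k) (2*[1+k] k) ⟩
    suc n C suc k              ≡⟨ nCk+nC[k+1]≡[n+1]C[k+1] n k ⟨
    (n C k) + (n C suc k)      ≡⟨ cong (λ i → (n C k) + (n C i)) n∸k≡1+k ⟨
    (n C k) + (n C (n ∸ k))    ≡⟨ cong ((n C k) +_) (nCk≡nC[n∸k] k≤n) ⟨
    (n C k) + (n C k)          ≡⟨ double (n C k) ⟩
    (n C k) * 2                ∎)
    where
    n = suc (2 * k)
    n≡k+[1+k] : ∀ k → suc (2 * k) ≡ k + suc k
    n≡k+[1+k] = solve-∀
    k≤n : k ≤ n
    k≤n = subst (k ≤_) (sym (n≡k+[1+k] k)) (ℕ.m≤m+n k (suc k))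
    n∸k≡1+k : n ∸ k ≡ suc k
    n∸k≡1+k = trans (cong (_∸ k) (n≡k+[1+k] k)) (ℕ.m+n∸m≡n k (suc k))
    double : ∀ x → x + x ≡ x * 2
    double = solve-∀

  -- The integers `A j k`: parity, ratios of neighbours, closed form.

  -- A j k = 4ᵏ C(j + k − 1/2, k), by Pascal's rule.
  A : ℕ → ℕ → ℕ
  A j       zero    = 1
  A zero    (suc k) = central (suc k)
  A (suc j) (suc k) = A j (suc k) + 4 * A (suc j) k

  -- Induction on `j`: Pascal's rule only adds a multiple of 4 to the previous row, and row 0
  -- consists of central binomial coefficients.
  2∣A : ∀ j k → 2 ℕ.∣ A j (suc k)
  2∣A zero    k = 2∣central k
  2∣A (suc j) k = ∣m∣n⇒∣m+n (2∣A j k) (ℕ.∣m⇒∣m*n (A (suc j) k) (divides 2 refl))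

  A-zero : ∀ k → A 0 k ≡ central k
  A-zero zero    = refl
  A-zero (suc k) = refl

  mutual
    -- The ratios of `A j (suc k)` and of `A (suc j) k` to `A j k` share the factor
    -- `2 * (j + k) + 1`, so comparing them eliminates `A j k`. Each ratio is in turn derived from
    -- Pascal's rule and this identity at a smaller `j + k`, hence the mutual recursion.
    A-absorption : ∀ j k → suc k * A j (suc k) ≡ 2 * (2 * j + 1) * A (suc j) k
    A-absorption j k = begin
      suc k * A j (suc k)               ≡⟨ A-sucʳ j k ⟩
      2 * (2 * (j + k) + 1) * A j k     ≡⟨ ℕ.*-assoc 2 (2 * (j + k) + 1) _ ⟩
      2 * ((2 * (j + k) + 1) * A j k)   ≡⟨ cong (2 *_) (A-sucˡ j k) ⟨
      2 * ((2 * j + 1) * A (suc j) k)   ≡⟨ ℕ.*-assoc 2 (2 * j + 1) _ ⟨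
      2 * (2 * j + 1) * A (suc j) k     ∎

    A-sucʳ : ∀ j k → suc k * A j (suc k) ≡ 2 * (2 * (j + k) + 1) * A j k
    A-sucʳ zero k = trans (central-suc k) (cong (2 * (2 * k + 1) *_) (sym (A-zero k)))
    A-sucʳ (suc j) k = begin
      suc k * (A j (suc k) + 4 * A (suc j) k)
        ≡⟨ ℕ.*-distribˡ-+ (suc k) (A j (suc k)) _ ⟩
      suc k * A j (suc k) + suc k * (4 * A (suc j) k)
        ≡⟨ cong (_+ suc k * (4 * A (suc j) k)) (A-absorption j k) ⟩
      2 * (2 * j + 1) * A (suc j) k + suc k * (4 * A (suc j) k)
        ≡⟨ collect j k (A (suc j) k) ⟩
      2 * (2 * (suc j + k) + 1) * A (suc j) k ∎
      where
      collect : ∀ j k x → 2 * (2 * j + 1) * x + suc k * (4 * x) ≡ 2 * (2 * (suc j + k) + 1) * x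
      collect = solve-∀

    A-sucˡ : ∀ j k → (2 * j + 1) * A (suc j) k ≡ (2 * (j + k) + 1) * A j k
    A-sucˡ j zero = cong (λ i → (2 * i + 1) * 1) (sym (ℕ.+-identityʳ j))
    A-sucˡ j (suc k) = begin
      (2 * j + 1) * (A j (suc k) + 4 * A (suc j) k)
        ≡⟨ expand j (A j (suc k)) (A (suc j) k) ⟩
      (2 * j + 1) * A j (suc k) + 2 * (2 * (2 * j + 1) * A (suc j) k)
        ≡⟨ cong (λ x → (2 * j + 1) * A j (suc k) + 2 * x) (A-absorption j k) ⟨
      (2 * j + 1) * A j (suc k) + 2 * (suc k * A j (suc k))
        ≡⟨ collect j k (A j (suc k)) ⟩
      (2 * (j + suc k) + 1) * A j (suc k) ∎
      where
      expand : ∀ j x y → (2 * j + 1) * (x + 4 * y) ≡ (2 * j + 1) * x + 2 * (2 * (2 * j + 1) * y)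
      expand = solve-∀
      collect : ∀ j k x → (2 * j + 1) * x + 2 * (suc k * x) ≡ (2 * (j + suc k) + 1) * x
      collect = solve-∀

  -- Induction on `k`: from `k` to `suc k` both sides grow by the ratio 2(2(j+k)+1)/(k+1). On the
  -- right, the factor `suc (j + k)` cancels between `central-suc` and `C-absorption`.
  A*central : ∀ j k → A j k * central j ≡ central (j + k) * ((j + k) C j)
  A*central j zero = begin
    1 * central j                      ≡⟨ ℕ.*-comm 1 (central j) ⟩
    central j * 1                      ≡⟨ cong₂ (λ i x → central i * x) (sym (ℕ.+-identityʳ j)) (sym jCj≡1) ⟩
    central (j + 0) * ((j + 0) C j)    ∎
    where
    instance
      _ = j ℕ.!* 0 !≢0
    jCj≡1 : (j + 0) C j ≡ 1
    jCj≡1 = ℕ.*-cancelʳ-≡ _ _ (j ! * 0 !) (begin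
      ((j + 0) C j) * (j ! * 0 !)  ≡⟨ [j+k]Cj*j!k!≡[j+k]! j 0 ⟩
      (j + 0) !                    ≡⟨ cong _! (ℕ.+-identityʳ j) ⟩
      j !                          ≡⟨ unit (j !) ⟩
      1 * (j ! * 0 !)              ∎)
      where
      unit : ∀ x → x ≡ 1 * (x * 1)
      unit = solve-∀
  A*central j (suc k) = ℕ.*-cancelˡ-≡ _ _ (suc k) (begin
    suc k * (A j (suc k) * central j)
      ≡⟨ ℕ.*-assoc (suc k) (A j (suc k)) (central j) ⟨
    suc k * A j (suc k) * central j
      ≡⟨ cong (_* central j) (A-sucʳ j k) ⟩
    2 * (2 * (j + k) + 1) * A j k * central j
      ≡⟨ ℕ.*-assoc (2 * (2 * (j + k) + 1)) _ _ ⟩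
    2 * (2 * (j + k) + 1) * (A j k * central j)
      ≡⟨ cong (2 * (2 * (j + k) + 1) *_) (A*central j k) ⟩
    2 * (2 * (j + k) + 1) * (central (j + k) * ((j + k) C j))
      ≡⟨ ℕ.*-assoc (2 * (2 * (j + k) + 1)) _ _ ⟨
    2 * (2 * (j + k) + 1) * central (j + k) * ((j + k) C j)
      ≡⟨ cong (_* ((j + k) C j)) (central-suc (j + k)) ⟨
    suc (j + k) * central (suc (j + k)) * ((j + k) C j)
      ≡⟨ swap (suc (j + k)) (central (suc (j + k))) _ ⟩
    central (suc (j + k)) * (suc (j + k) * ((j + k) C j))
      ≡⟨ cong (central (suc (j + k)) *_) (C-absorption j k) ⟨
    central (suc (j + k)) * (suc k * (suc (j + k) C j))
      ≡⟨ swap′ (central (suc (j + k))) (suc k) _ ⟩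
    suc k * (central (suc (j + k)) * (suc (j + k) C j))
      ≡⟨ cong (λ i → suc k * (central i * (i C j))) (ℕ.+-suc j k) ⟨
    suc k * (central (j + suc k) * ((j + suc k) C j)) ∎)
    where
    swap : ∀ x y z → x * y * z ≡ y * (x * z)
    swap = solve-∀
    swap′ : ∀ x y z → x * (y * z) ≡ y * (x * z)
    swap′ = solve-∀

  A[n,2n]*central : ∀ n → A n (2 * n) * central n ≡ ((6 * n) C (3 * n)) * ((3 * n) C n)
  A[n,2n]*central n = trans (A*central n (2 * n))
    -- `n + 2 * n` computes to `3 * n`; only `2 * (3 * n)` has to be rewritten as `6 * n`.
    (cong (λ i → (i C (3 * n)) * ((3 * n) C n)) (sym (ℕ.*-assoc 2 3 n)))

  -- Divisibility by 2(2n+1) and by 2n+3.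

  -- Since (2k+1)² = 4(k²+k) + 1, the number 4 is invertible modulo 2k+1.
  odd∣4x⇒odd∣x : ∀ k x → 2 * k + 1 ℕ.∣ 4 * x → 2 * k + 1 ℕ.∣ x
  odd∣4x⇒odd∣x k x odd∣4x =
    ∣m+n∣m⇒∣n
      (subst (2 * k + 1 ℕ.∣_) (square k x) (m∣m*n ((2 * k + 1) * x)))
      (∣n⇒∣m*n (k * k + k) odd∣4x)
    where
    square : ∀ k x → (2 * k + 1) * ((2 * k + 1) * x) ≡ (k * k + k) * (4 * x) + x
    square = solve-∀

  -- Absorption shows that 2n+1 divides 2n·a, and 2n ≡ -1 (mod 2n+1), so 2n+1 divides a. As 2n+1 is
  -- odd, the quotient inherits the evenness of a.
  2[2n+1]∣A : ∀ m → let n = suc m in 2 * (2 * n + 1) ℕ.∣ A n (suc (suc (2 * m)))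
  2[2n+1]∣A m = from-quotient 2n+1∣a
    where
    n = suc m
    a = A n (suc (suc (2 * m)))
    step : ∀ m a → (2 * suc m + 1) * a ≡ suc (suc (2 * m)) * a + a
    step = solve-∀
    2n+1∣a : 2 * n + 1 ℕ.∣ a
    2n+1∣a = ∣m+n∣m⇒∣n
      (subst (2 * n + 1 ℕ.∣_) (step m a) (m∣m*n a))
      (subst (2 * n + 1 ℕ.∣_) (sym (A-absorption n (suc (2 * m))))
        (ℕ.∣m⇒∣m*n (A (suc n) (suc (2 * m))) (n∣m*n 2)))
    split : ∀ n q → q * (2 * n + 1) ≡ 2 * (n * q) + q
    split = solve-∀
    from-quotient : 2 * n + 1 ℕ.∣ a → 2 * (2 * n + 1) ℕ.∣ a
    from-quotient (divides q a≡q[2n+1]) =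
      subst (2 * (2 * n + 1) ℕ.∣_) (sym a≡q[2n+1])
        (ℕ.*-monoˡ-∣ (2 * n + 1)
          (∣m+n∣m⇒∣n
            (subst (2 ℕ.∣_) (trans a≡q[2n+1] (split n q)) (2∣A n (suc (2 * m))))
            (m∣m*n (n * q))))

  2n+3∣3s : ∀ m s → let n = suc m in
    A n (suc (suc (2 * m))) ≡ s * (2 * (2 * n + 1)) → 2 * n + 3 ℕ.∣ 3 * s
  2n+3∣3s m s a≡ = subst (ℕ._∣ 3 * s) (sym (odd n))
    (odd∣4x⇒odd∣x (suc n) (3 * s)
      (∣m+n∣m⇒∣n
        -- With N = 2n+3, equating N²s - 7Ns + 12s with 2ND gives N²s + 12s = (2D + 7s)N, which
        -- avoids subtraction.
        (divides (2 * A (suc (suc n)) (2 * m) + 7 * s) (reduce m s D n[2n-1]s))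
        (m∣m*n ((2 * suc n + 1) * s))))
    where
    n = suc m
    B = A (suc n) (suc (2 * m))
    D = A (suc (suc n)) (2 * m)
    odd : ∀ n → 2 * n + 3 ≡ 2 * suc n + 1
    odd = solve-∀
    -- The factor 2(2n+1) in `a≡` is the one produced by absorption, so it cancels.
    ns≡B : suc (suc (2 * m)) * s ≡ B
    ns≡B = ℕ.*-cancelˡ-≡ _ _ (2 * (2 * n + 1)) (begin
      2 * (2 * n + 1) * (suc (suc (2 * m)) * s)    ≡⟨ swap (2 * (2 * n + 1)) (suc (suc (2 * m))) s ⟩
      suc (suc (2 * m)) * (s * (2 * (2 * n + 1)))  ≡⟨ cong (suc (suc (2 * m)) *_) a≡ ⟨
      suc (suc (2 * m)) * A n (suc (suc (2 * m)))  ≡⟨ A-absorption n (suc (2 * m)) ⟩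
      2 * (2 * n + 1) * B                          ∎)
      where
      swap : ∀ x y z → x * (y * z) ≡ y * (z * x)
      swap = solve-∀
    -- The second absorption, at `suc n`, brings in the factor 2(n+1)+1 = 2n+3.
    n[2n-1]s : suc (2 * m) * (suc (suc (2 * m)) * s) ≡ 2 * (2 * suc n + 1) * D
    n[2n-1]s = trans (cong (suc (2 * m) *_) ns≡B) (A-absorption (suc n) (2 * m))
    -- 2n(2n−1) = (N − 3)(N − 4) = N² − 7N + 12 for N = 2n + 3.
    reduce : ∀ m s D → suc (2 * m) * (suc (suc (2 * m)) * s) ≡ 2 * (2 * suc (suc m) + 1) * D →
      (2 * suc (suc m) + 1) * ((2 * suc (suc m) + 1) * s) + 4 * (3 * s)
        ≡ (2 * D + 7 * s) * (2 * suc (suc m) + 1)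
    reduce m s D eq = trans (lhs m s) (trans (cong (_+ 7 * s * (2 * suc (suc m) + 1)) eq) (rhs m s D))
      where
      lhs : ∀ m s → (2 * suc (suc m) + 1) * ((2 * suc (suc m) + 1) * s) + 4 * (3 * s)
        ≡ suc (2 * m) * (suc (suc (2 * m)) * s) + 7 * s * (2 * suc (suc m) + 1)
      lhs = solve-∀
      rhs : ∀ m s D → 2 * (2 * suc (suc m) + 1) * D + 7 * s * (2 * suc (suc m) + 1)
        ≡ (2 * D + 7 * s) * (2 * suc (suc m) + 1)
      rhs = solve-∀

-- Transfer to ℚ and ℤ.

open import Data.Integer.Base as ℤ using (+_; _+_; _*_)

n/1≡p/q : ∀ n p q .{{_ : NonZero q}} → n ℕ.* q ≡ p → + n / 1 ≡ + p / q
-- `mkℚᵘ` stores the denominator minus one, so `0` stands for denominator 1 and `q` for `suc q`.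
-- Cross-multiplication then suffices, without reducing fractions.
n/1≡p/q n p (suc q) nq≡p = fromℚᵘ-cong {mkℚᵘ (+ n) 0} {mkℚᵘ (+ p) q} (*≡* (begin
  + n * + suc q   ≡⟨ ℤ.pos-* n (suc q) ⟨
  + (n ℕ.* suc q) ≡⟨ cong +_ nq≡p ⟩
  + p             ≡⟨ ℤ.*-identityʳ (+ p) ⟨
  + p * + 1       ∎))

s/1≡S : ∀ n s → A n (2 ℕ.* n) ≡ s ℕ.* (2 ℕ.* (2 ℕ.* n ℕ.+ 1)) → + s / 1 ≡ S n
s/1≡S n s A≡ = n/1≡p/q s numerator denominator (begin
  s ℕ.* denominator                            ≡⟨ ℕ.*-assoc s (2 ℕ.* (2 ℕ.* n ℕ.+ 1)) (central n) ⟨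
  s ℕ.* (2 ℕ.* (2 ℕ.* n ℕ.+ 1)) ℕ.* central n  ≡⟨ cong (ℕ._* central n) A≡ ⟨
  A n (2 ℕ.* n) ℕ.* central n                  ≡⟨ A[n,2n]*central n ⟩
  numerator                                    ∎)
  where
  numerator = ((6 ℕ.* n) C (3 ℕ.* n)) ℕ.* ((3 ℕ.* n) C n)
  denominator = 2 ℕ.* (2 ℕ.* n ℕ.+ 1) ℕ.* central n
  instance
    2n+1≢0 : NonZero (2 ℕ.* n ℕ.+ 1)
    2n+1≢0 = ℕ.>-nonZero (ℕ.m≤n+m 1 (2 ℕ.* n))
    denominator≢0 : NonZero denominator
    denominator≢0 = ℕ.m*n≢0 _ _ {{ℕ.m*n≢0 2 (2 ℕ.* n ℕ.+ 1)}} {{nCk≢0 (ℕ.m≤m+n n (1 ℕ.* n))}}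

theorem1p1 : (n : ℕ) → .{{_ : NonZero n}} →
    ∃[ s ] ((s / 1 ≡ S n) × (+ 3 * s ≡ + 0 [mod (+ 2 * + n + + 3) ]))
theorem1p1 n@(suc m) = + s , s/1≡S n s (trans (cong (A n) (2*[1+k] m)) A≡) , ∣ᵤ⇒∣ modulus∣
  where
  -- Projections, because a with-abstraction would normalise S (suc m).
  s = ℕ.quotient (2[2n+1]∣A m)
  A≡ = ℕ._∣_.equality (2[2n+1]∣A m)
  -- Both integers are images of naturals, so their absolute values are those naturals.
  modulus∣ : ℤ.∣ + 2 * + n + + 3 ∣ ℕ.∣ ℤ.∣ + 3 * + s ℤ.- + 0 ∣
  modulus∣ = subst₂ (λ i j → ℤ.∣ i + + 3 ∣ ℕ.∣ ℤ.∣ j ∣)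
    (ℤ.pos-* 2 n)
    (trans (ℤ.pos-* 3 s) (sym (ℤ.+-identityʳ (+ 3 * + s))))
    (2n+3∣3s m s A≡)
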